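{- Let $G$ be a finite non-cyclic nilpotent group. Then the non-cyclic graph $\Gamma(G)$ does not admit a total perfect code.
   Context: For a finite non-cyclic group $G$, $\mathrm{Cyc}(G)=\{x\in G:\langle x,y\rangle\text{ is cyclic for all }y\in G\}$. The non-cyclic graph $\Gamma(G)$ is the simple undirected graph with vertex set $G\setminus\mathrm{Cyc}(G)$ in which two distinct vertices $x,y$ are adjacent if and only if the subgroup $\langle x,y\rangle$ is not cyclic. A total perfect code of a graph $\Gamma$ is a subset $T\subseteq V(\Gamma)$ such that every vertex of $\Gamma$ (including those in $T$) is adjacent to exactly one vertex in $T$. -}

module Defs where

open import Algebra.Bundles using (Group)
open import Data.Fin.Base using (Fin)
open import Data.Nat.Base using (ℕ; zero; suc)
open import Data.Product using (∃; ∃!; _×_; _,_; proj₁; proj₂)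
open import Data.Sum.Base using (_⊎_; inj₁; inj₂; swap)
open import Function.Base using (_∘_)
open import Function.Bundles using (Inverse)
open import Level using (Level; Lift; _⊔_)
open import Relation.Binary.Bundles using (Setoid)
open import Relation.Binary.Core using (Rel)
open import Relation.Binary.Definitions
  using (Irreflexive; Symmetric; _Respects_; _Respects₂_)
import Relation.Binary.Construct.On as On
open import Relation.Binary.PropositionalEquality using (setoid)
open import Relation.Nullary.Negation using (¬_)
open import Relation.Unary using (Pred; U; _∈_; _∉_; _⊆_; _≐_)
open import Relation.Unary.Properties using (≐-sym; ≐-trans)

record Graph (v ℓ a : Level) : Set (Level.suc (v ⊔ ℓ ⊔ a)) where
  infix 4 _~_
  field
    vertices : Setoid v ℓ
  open Setoid vertices public using (_≈_) renaming (Carrier to Vertex)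
  field
    _~_    : Rel Vertex a
    ~-resp : _~_ Respects₂ _≈_
    sym    : Symmetric _~_
    irrefl : Irreflexive _≈_ _~_

-- Subsets of a setoid are predicates closed under its equality, hence `resp`.
record IsTotalPerfectCode {v ℓ a t} (Γ : Graph v ℓ a)
                          (T : Pred (Graph.Vertex Γ) t) : Set (v ⊔ ℓ ⊔ a ⊔ t) where
  open Graph Γ
  field
    resp             : T Respects _≈_
    unique-neighbour : ∀ x → ∃! _≈_ (λ y → y ∈ T × x ~ y)

module _ {c ℓ} (G : Group c ℓ) where
  open Group G renaming (setoid to ≈-setoid; sym to ≈-sym; trans to ≈-trans)

  IsFinite : Set (c ⊔ ℓ)
  IsFinite = ∃ λ n → Inverse ≈-setoid (setoid (Fin n))

  -- The subgroup generated by S.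
  data Gen {p} (S : Pred Carrier p) : Pred Carrier (c ⊔ ℓ ⊔ p) where
    gen   : ∀ {x} → x ∈ S → x ∈ Gen S
    unit  : ε ∈ Gen S
    mul   : ∀ {x y} → x ∈ Gen S → y ∈ Gen S → x ∙ y ∈ Gen S
    inv   : ∀ {x} → x ∈ Gen S → x ⁻¹ ∈ Gen S
    resp  : ∀ {x y} → x ≈ y → x ∈ Gen S → y ∈ Gen S

  ⟨_⟩₁ : Carrier → Pred Carrier (c ⊔ ℓ)
  ⟨ x ⟩₁ = Gen (_≈ x)

  ⟨_,_⟩ : Carrier → Carrier → Pred Carrier (c ⊔ ℓ)
  ⟨ x , y ⟩ = Gen (λ g → g ≈ x ⊎ g ≈ y)

  IsCyclicSubgroup : ∀ {p} → Pred Carrier p → Set (c ⊔ ℓ ⊔ p)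
  IsCyclicSubgroup H = ∃ λ z → H ≐ ⟨ z ⟩₁

  IsCyclic : Set (c ⊔ ℓ)
  IsCyclic = IsCyclicSubgroup U

  [_,_] : Carrier → Carrier → Carrier
  [ x , y ] = x ∙ y ∙ x ⁻¹ ∙ y ⁻¹

  -- The upper central series: x lies in Zₙ₊₁ iff its image is central in G / Zₙ,
  -- i.e. iff [ x , y ] ∈ Zₙ for every y.
  UpperCentral : ℕ → Pred Carrier (c ⊔ ℓ)
  UpperCentral zero    x = Lift c (x ≈ ε)
  UpperCentral (suc n) x = ∀ y → [ x , y ] ∈ UpperCentral n

  IsNilpotent : Set (c ⊔ ℓ)
  IsNilpotent = ∃ λ n → ∀ x → x ∈ UpperCentral n

  Cyc : Pred Carrier (c ⊔ ℓ)
  Cyc x = ∀ y → IsCyclicSubgroup ⟨ x , y ⟩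

  private
    Gen-mono : ∀ {p q} {S : Pred Carrier p} {S′ : Pred Carrier q} →
               S ⊆ S′ → Gen S ⊆ Gen S′
    Gen-mono f (gen s)    = gen (f s)
    Gen-mono f unit       = unit
    Gen-mono f (mul a b)  = mul (Gen-mono f a) (Gen-mono f b)
    Gen-mono f (inv a)    = inv (Gen-mono f a)
    Gen-mono f (resp e a) = resp e (Gen-mono f a)

    cyclic-resp : ∀ {p q} {H : Pred Carrier p} {K : Pred Carrier q} →
                  H ≐ K → IsCyclicSubgroup H → IsCyclicSubgroup K
    cyclic-resp H≐K (z , H≐⟨z⟩) = z , ≐-trans (≐-sym H≐K) H≐⟨z⟩

    pair-swap : ∀ x y → ⟨ x , y ⟩ ≐ ⟨ y , x ⟩
    pair-swap x y = Gen-mono swap , Gen-mono swap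

    pair-congʳ : ∀ x {y z} → y ≈ z → ⟨ x , y ⟩ ≐ ⟨ x , z ⟩
    pair-congʳ x y≈z = Gen-mono (step y≈z) , Gen-mono (step (≈-sym y≈z))
      where
      step : ∀ {y z g} → y ≈ z → g ≈ x ⊎ g ≈ y → g ≈ x ⊎ g ≈ z
      step y≈z (inj₁ e) = inj₁ e
      step y≈z (inj₂ e) = inj₂ (≈-trans e y≈z)

  NonCyclicVertex : Set (c ⊔ ℓ)
  NonCyclicVertex = ∃ λ x → x ∉ Cyc

  Adjacent : Rel NonCyclicVertex (c ⊔ ℓ)
  Adjacent (x , _) (y , _) = ¬ x ≈ y × ¬ IsCyclicSubgroup ⟨ x , y ⟩

  nonCyclicGraph : Graph (c ⊔ ℓ) ℓ (c ⊔ ℓ)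
  nonCyclicGraph = record
    { vertices = On.setoid ≈-setoid (proj₁ {B = _∉ Cyc})
    ; _~_      = Adjacent
    ; ~-resp   = (λ {x} {y} {z} → respʳ {x} {y} {z})
               , (λ {y} {x} {z} x≈z → symm {y} {z} ∘ respʳ {y} {x} {z} x≈z ∘ symm {x} {y})
    ; sym      = λ {x} {y} → symm {x} {y}
    ; irrefl   = λ x≈y (x≉y , _) → x≉y x≈y
    }
    where
    respʳ : ∀ {x y z : NonCyclicVertex} → proj₁ y ≈ proj₁ z → Adjacent x y → Adjacent x z
    respʳ {x , _} y≈z (x≉y , nc) =
      (λ x≈z → x≉y (≈-trans x≈z (≈-sym y≈z))) ,
      nc ∘ cyclic-resp (≐-sym (pair-congʳ x y≈z))

    symm : ∀ {x y : NonCyclicVertex} → Adjacent x y → Adjacent y x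
    symm {x , _} {y , _} (x≉y , nc) = x≉y ∘ ≈-sym , nc ∘ cyclic-resp (pair-swap y x)

{-# OPTIONS --safe #-}

-- For adjacent a and b, each of ⟨ a b , a ⟩ and ⟨ a b , b ⟩ is all of ⟨ a , b ⟩, so a b is a
-- vertex adjacent to both a and b: every edge of Γ(G) lies in a triangle.  A total perfect code
-- contains an edge a ~ b as soon as Γ(G) has a vertex, and then a b has two neighbours in the code.
-- A vertex exists because a finite group whose 2-generated subgroups are all cyclic is cyclic.

module Submission where

open import Defs
open import Algebra.Bundles using (Group)
import Algebra.Properties.Group as GroupProperties
open import Data.Fin.Base using (Fin; zero; suc)
open import Data.Nat.Base using (zero; suc)
open import Data.Product using (∃; _×_; _,_; proj₁; proj₂)
open import Data.Sum.Base using (inj₁; inj₂; [_,_]′)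
open import Function.Base using (_∘_)
open import Function.Bundles using (Inverse)
open import Relation.Nullary.Negation using (¬_)
open import Relation.Unary using (Pred; _⊆_; _≐_; _∈_)
open import Relation.Unary.Properties using (≐-sym; ≐-trans)

module _ {c ℓ} (G : Group c ℓ) where
  open Group G
  open GroupProperties G using (//-rightDividesʳ; \\-leftDividesʳ)

  Gen-least : ∀ {p q} {S : Pred Carrier p} {S′ : Pred Carrier q} →
              S ⊆ Gen G S′ → Gen G S ⊆ Gen G S′
  Gen-least f (gen s)    = f s
  Gen-least f unit       = unit
  Gen-least f (mul a b)  = mul (Gen-least f a) (Gen-least f b)
  Gen-least f (inv a)    = inv (Gen-least f a)
  Gen-least f (resp e a) = resp e (Gen-least f a)

  pair-least : ∀ {p x y} {S : Pred Carrier p} →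
               x ∈ Gen G S → y ∈ Gen G S → ⟨_,_⟩ G x y ⊆ Gen G S
  pair-least x∈ y∈ = Gen-least [ (λ e → resp (sym e) x∈) , (λ e → resp (sym e) y∈) ]′

  left∈ : ∀ {x y} → x ∈ ⟨_,_⟩ G x y
  left∈ = gen (inj₁ refl)

  right∈ : ∀ {x y} → y ∈ ⟨_,_⟩ G x y
  right∈ = gen (inj₂ refl)

  product-left : ∀ x y → ⟨_,_⟩ G (x ∙ y) x ≐ ⟨_,_⟩ G x y
  product-left x y =
    pair-least (mul left∈ right∈) left∈ ,
    -- Here `y` is recovered as `x ⁻¹ ∙ (x ∙ y)`.
    pair-least right∈ (resp (\\-leftDividesʳ x y) (mul (inv right∈) left∈))

  product-right : ∀ x y → ⟨_,_⟩ G (x ∙ y) y ≐ ⟨_,_⟩ G x y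
  product-right x y =
    pair-least (mul left∈ right∈) right∈ ,
    pair-least (resp (//-rightDividesʳ y x) (mul left∈ (inv right∈))) right∈

  cyclic-resp : ∀ {p q} {H : Pred Carrier p} {K : Pred Carrier q} →
                H ≐ K → IsCyclicSubgroup G H → IsCyclicSubgroup G K
  cyclic-resp H≐K (z , H≐⟨z⟩) = z , ≐-trans (≐-sym H≐K) H≐⟨z⟩

  -- If `x ≈ y`, the pair generates just `⟨ y ⟩₁`.
  nonCyclic⇒≉ : ∀ {x y} → ¬ IsCyclicSubgroup G (⟨_,_⟩ G x y) → ¬ x ≈ y
  nonCyclic⇒≉ {y = y} nc x≈y =
    nc (y , pair-least (gen x≈y) (gen refl) , Gen-least (gen ∘ inj₂))

  edge-in-triangle : ∀ {a b} → Adjacent G a b → ∃ λ w → Adjacent G w a × Adjacent G w b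
  edge-in-triangle {a , _} {b , _} (_ , nc) =
    (a ∙ b , λ ab∈Cyc → nca (ab∈Cyc a)) , (nonCyclic⇒≉ nca , nca) , (nonCyclic⇒≉ ncb , ncb)
    where
    nca : ¬ IsCyclicSubgroup G (⟨_,_⟩ G (a ∙ b) a)
    nca = nc ∘ cyclic-resp (product-left a b)

    ncb : ¬ IsCyclicSubgroup G (⟨_,_⟩ G (a ∙ b) b)
    ncb = nc ∘ cyclic-resp (product-right a b)

  -- Double negations: Cyc is not decidable for a group given only as a setoid bijection with
  -- Fin n, and only a contradiction is needed in the end.
  common-cyclic : (∀ x → ¬ ¬ Cyc G x) → ∀ k (f : Fin k → Carrier) →
                  ¬ ¬ (∃ λ z → ∀ i → f i ∈ ⟨_⟩₁ G z)
  common-cyclic cyc zero    f ¬z = ¬z (ε , λ ())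
  common-cyclic cyc (suc k) f ¬z =
    common-cyclic cyc k (f ∘ suc) λ (z , f∈⟨z⟩) → cyc z λ z∈Cyc →
      -- `z` already covers the tail of `f`; a generator `w` of the cyclic group `⟨ z , f zero ⟩`
      -- covers both the tail and `f zero`.
      let (w , ⟨z,f₀⟩⊆⟨w⟩ , _) = z∈Cyc (f zero)
      in ¬z (w , λ where
           zero    → ⟨z,f₀⟩⊆⟨w⟩ right∈
           (suc i) → Gen-least (λ e → resp (sym e) (⟨z,f₀⟩⊆⟨w⟩ left∈)) (f∈⟨z⟩ i))

  -- Without vertices no element lies outside `Cyc`, so `common-cyclic`, applied to the enumeration
  -- `from` of the whole group, yields a generator of `G`.
  vertex-exists : IsFinite G → ¬ IsCyclic G → ¬ ¬ NonCyclicVertex G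
  vertex-exists (n , bij) ¬cyclic ¬vertex =
    common-cyclic (λ x x∉Cyc → ¬vertex (x , x∉Cyc)) n from λ (z , from∈⟨z⟩) →
      ¬cyclic (z , (λ {x} _ → resp (strictlyInverseʳ x) (from∈⟨z⟩ (to x))) , _)
    where open Inverse bij using (to; from; strictlyInverseʳ)

theorem4p4 : ∀ {c ℓ t} (G : Group c ℓ) → IsFinite G → ¬ IsCyclic G → IsNilpotent G →
    ¬ (∃ λ (T : Pred (Graph.Vertex (nonCyclicGraph G)) t) → IsTotalPerfectCode (nonCyclicGraph G) T)
theorem4p4 G finite ¬cyclic _ (T , code) = vertex-exists G finite ¬cyclic λ v →
  -- The vertex `v` only provides some `a` in `T`; since code vertices also need a neighbour in `T`,
  -- `a` has a partner `b` there.
  let (a , (a∈T , _) , _)         = unique-neighbour v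
      (b , (b∈T , a~b) , _)       = unique-neighbour a
      (w , w~a , w~b)             = edge-in-triangle G {a} {b} a~b
      (_ , _ , unique)            = unique-neighbour w
  -- Uniqueness at `w` identifies `a` with `b`, but adjacent vertices are distinct.
  in proj₁ a~b (trans (sym (unique {a} (a∈T , w~a))) (unique {b} (b∈T , w~b)))
  where
  open IsTotalPerfectCode code using (unique-neighbour)
  open Group G using (sym; trans)
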